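{- For every finite bipartite graph $G=(A,B,E)$ and every $\epsilon>0$, every execution of the ALT-algorithm without freezing mechanism (described in the context) on $G$ with parameter $\epsilon$ returns a $(1-\epsilon)$-approximation to Maximum Matching, i.e. a matching $M$ of $G$ with $|M|\ge(1-\epsilon)\,|OPT|$, where $OPT$ is a maximum matching of $G$.
   Context: A matching is a set of pairwise vertex-disjoint edges; it is maximal (in a graph) if no edge of the graph can be added to it, and maximum if it has the largest possible size. For a matching $N$, $A(N)$ and $B(N)$ denote the sets of $A$-vertices and $B$-vertices incident to edges of $N$. $\Gamma(v)$ denotes the neighbourhood of $v$ in $G$. ALT-algorithm (version without freezing) on $G=(A,B,E)$ with parameter $\epsilon>0$: Initialize $M=\varnothing$ and $c(b)=0$ for all $b\in B$. For each round (iteration) $r=1,2,\ldots,49/\epsilon^2$ (i.e. each integer $r$ with $1\le r\le 49/\epsilon^2$): (i) for every $a\in A\setminus A(M)$ let $c_{\min}(a):=\min\{c(b): b\in\Gamma(a)\}$; (ii) let $H_r\subseteq G$ be the subgraph spanned by all edges $ab\in E$ with $a\in A\setminus A(M)$, $b\in B$ and $c(b)=c_{\min}(a)$ (isolated vertices contribute no edges); (iii) compute an arbitrary maximal matching $N_r$ in $H_r$; (iv) set $M\gets\{ab\in M: b\notin B(N_r)\}\cup N_r$; (v) increase $c(b)$ by $1$ for each $b\in B(N_r)$. Finally return $M$. An execution is determined by the choices of the maximal matchings $N_r$. -}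

module Defs where

open import Algebra.Bundles using (CommutativeRing)
import Algebra.Definitions.RawMonoid as RawMonoidDefinitions
open import Data.Bool.Base using (if_then_else_)
open import Data.Fin.Base using (Fin)
import Data.Fin.Properties as Fin
open import Data.List.Base using (List; []; _∷_; _++_; map; filter; length)
open import Data.List.Membership.Propositional using (_∈_; _∉_)
import Data.List.Membership.DecPropositional as DecMembership
open import Data.List.Relation.Unary.All using (All)
open import Data.List.Relation.Unary.AllPairs using (AllPairs)
open import Data.Nat.Base using (ℕ; zero; suc; _≤_)
open import Data.Product.Base using (∃; ∃-syntax; _×_; _,_; proj₁; proj₂; uncurry)
open import Data.Sum.Base using (_⊎_; inj₂)
open import Level using (Level; _⊔_; 0ℓ) renaming (suc to lsuc)
open import Relation.Binary.Core using (Rel; REL)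
open import Relation.Binary.Definitions using (Cotransitive; Tight; Decidable)
open import Relation.Binary.PropositionalEquality using (_≡_; _≢_)
open import Relation.Binary.Structures using (IsStrictPartialOrder)
open import Relation.Nullary.Decidable.Core using (¬?; does)
open import Relation.Nullary.Negation.Core using (¬_)

-- The scalars in which ε lives. Classically the Archimedean ordered fields are
-- exactly the ordered subfields of ℝ. The order axioms are given in terms of _<_
-- (cotransitivity and tightness in place of trichotomy), so that not only ℚ
-- but also the constructive real numbers form a model.

record ArchimedeanOrderedField (c ℓ₁ ℓ₂ : Level) : Set (lsuc (c ⊔ ℓ₁ ⊔ ℓ₂)) where
  infix 4 _<_ _#_ _≤ᶠ_
  field
    commutativeRing : CommutativeRing c ℓ₁
  open CommutativeRing commutativeRing public
    renaming (_+_ to _+ᶠ_; _*_ to _*ᶠ_; _-_ to _-ᶠ_; -_ to -ᶠ_)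
  open RawMonoidDefinitions +-rawMonoid using () renaming (_×_ to _·ᶠ_)

  field
    _<_ : Rel Carrier ℓ₂

  _#_ : Rel Carrier ℓ₂
  x # y = (x < y) ⊎ (y < x)

  _≤ᶠ_ : Rel Carrier ℓ₂
  x ≤ᶠ y = ¬ (y < x)

  fromℕ : ℕ → Carrier
  fromℕ n = n ·ᶠ 1#

  field
    <-isStrictPartialOrder : IsStrictPartialOrder _≈_ _<_
    <-cotrans              : Cotransitive _<_
    #-tight                : Tight _≈_ _#_
    0<1                    : 0# < 1#
    +-monoˡ-<              : ∀ {x y} z → x < y → x +ᶠ z < y +ᶠ z
    *-positive             : ∀ {x y} → 0# < x → 0# < y → 0# < x *ᶠ y
    #0⇒invertible          : ∀ x → x # 0# → ∃[ y ] x *ᶠ y ≈ 1#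
    archimedean            : ∀ x → ∃[ n ] x < fromℕ n

  recip : ∀ x → 0# < x → Carrier
  recip x 0<x = proj₁ (#0⇒invertible x (inj₂ 0<x))

  IsFloor : Carrier → ℕ → Set ℓ₂
  IsFloor x n = fromℕ n ≤ᶠ x × x < fromℕ (suc n)

record BipartiteGraph : Set₁ where
  infix 4 _~_ _~?_
  field
    ∣A∣ ∣B∣ : ℕ
    _~_     : REL (Fin ∣A∣) (Fin ∣B∣) 0ℓ
    _~?_    : Decidable _~_

module Matchings (G : BipartiteGraph) where
  open BipartiteGraph G

  Edge : Set
  Edge = Fin ∣A∣ × Fin ∣B∣

  Disjoint : Rel Edge 0ℓ
  Disjoint (a , b) (a′ , b′) = a ≢ a′ × b ≢ b′

  -- Edge sets are lists. In a matching, pairwise disjointness excludes repeated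
  -- entries, so that length is cardinality.
  -- H is the edge relation of a bipartite graph on the vertex classes of G.
  IsMatching : REL (Fin ∣A∣) (Fin ∣B∣) 0ℓ → List Edge → Set
  IsMatching H N = All (uncurry H) N × AllPairs Disjoint N

  IsMaximalMatching : REL (Fin ∣A∣) (Fin ∣B∣) 0ℓ → List Edge → Set
  IsMaximalMatching H N =
    IsMatching H N × (∀ e → uncurry H e → ¬ IsMatching H (e ∷ N))

  IsMaximumMatching : REL (Fin ∣A∣) (Fin ∣B∣) 0ℓ → List Edge → Set
  IsMaximumMatching H N =
    IsMatching H N × (∀ N′ → IsMatching H N′ → length N′ ≤ length N)

  A⟨_⟩ : List Edge → List (Fin ∣A∣)
  A⟨ N ⟩ = map proj₁ N

  B⟨_⟩ : List Edge → List (Fin ∣B∣)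
  B⟨ N ⟩ = map proj₂ N

module ALT (G : BipartiteGraph) where
  open BipartiteGraph G
  open Matchings G
  open DecMembership (Fin._≟_ {∣B∣}) using (_∈?_)

  record State : Set where
    constructor ⟨_,_⟩
    field
      M : List Edge
      c : Fin ∣B∣ → ℕ

  -- A relation rather than a function, as the minimum does not exist
  -- when a has no neighbours.
  IsCMin : (Fin ∣B∣ → ℕ) → Fin ∣A∣ → ℕ → Set
  IsCMin c a k = (∃[ b ] a ~ b × c b ≡ k) × (∀ b → a ~ b → k ≤ c b)

  H : State → REL (Fin ∣A∣) (Fin ∣B∣) 0ℓ
  H ⟨ M , c ⟩ a b = a ~ b × a ∉ A⟨ M ⟩ × IsCMin c a (c b)

  update : State → List Edge → State
  update ⟨ M , c ⟩ N =
    ⟨ filter (λ e → ¬? (proj₂ e ∈? B⟨ N ⟩)) M ++ N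
    , (λ b → if does (b ∈? B⟨ N ⟩) then suc (c b) else c b)
    ⟩

  -- Reachable r s: some choice of N₁, …, N_r leads to the state s.
  data Reachable : ℕ → State → Set where
    start : Reachable zero ⟨ [] , (λ _ → zero) ⟩
    round : ∀ {r s} N → Reachable r s → IsMaximalMatching (H s) N →
            Reachable (suc r) (update s N)

  module _ {c ℓ₁ ℓ₂} (F : ArchimedeanOrderedField c ℓ₁ ℓ₂) where
    open ArchimedeanOrderedField F

    -- Some execution with parameter ε returns M; since the rounds are the
    -- integers r with 1 ≤ r ≤ 49/ε², there are ⌊49/ε²⌋ of them.
    Returns : (ε : Carrier) → 0# < ε → List Edge → Set ℓ₂
    Returns ε 0<ε M =
      ∃[ R ] IsFloor (fromℕ 49 *ᶠ recip (ε *ᶠ ε) (*-positive 0<ε 0<ε)) R ×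
      ∃[ p ] Reachable R ⟨ M , p ⟩

{-# OPTIONS --safe #-}

-- Cap all prices at L ≈ √R. In every round each vertex of A(OPT) that is unmatched
-- and has a neighbour of price below L (a bidder) either gets matched, which raises a
-- price, or sees its cheapest price rise. So the total number of bids over the R rounds
-- is at most the final value of the potential: capped prices plus capped cheapest
-- prices, which is at most 2L|OPT|. In each round, weak LP duality bounds
-- L(|OPT| − |M|) by |M| + L · (number of bidders), as a matched vertex pays at most 1
-- more than its cheapest price. Since |M| never decreases, summing over the rounds gives
-- |OPT| − |M| ≤ (1/L + 2L/R)|OPT| ≤ ε|OPT| for ε ≤ 1.

module Submission where

open import Defs
open import Data.Bool.Base using (if_then_else_)
open import Data.Fin.Base using (Fin)
import Data.Fin.Properties as Fin
open import Data.List.Base using (List; []; _∷_; _++_; map; filter; length; allFin)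
import Data.List.Extrema.Nat as Extrema
open import Data.List.Membership.Propositional using (_∈_; _∉_)
import Data.List.Membership.DecPropositional as DecMembership
open import Data.List.Membership.Propositional.Properties
  using (∈-map⁺; ∈-map⁻; ∈-++⁺ˡ; ∈-++⁺ʳ; ∈-++⁻; ∈-∃++; ∈-filter⁺; ∈-filter⁻; ∈-allFin)
open import Data.List.Properties using (map-∘)
open import Data.List.Relation.Binary.Permutation.Propositional using (_↭_)
open import Data.List.Relation.Binary.Permutation.Propositional.Properties
  using (shift; map⁺; ∈-resp-↭)
open import Data.List.Relation.Unary.All as All using (All; []; _∷_)
import Data.List.Relation.Unary.All.Properties as All
open import Data.List.Relation.Unary.AllPairs as AllPairs using (AllPairs; []; _∷_)
import Data.List.Relation.Unary.AllPairs.Properties as AllPairs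
open import Data.List.Relation.Unary.Any using (here; there)
open import Data.List.Relation.Unary.Unique.Propositional using (Unique)
open import Data.List.Relation.Unary.Unique.Propositional.Properties using (allFin⁺)
open import Data.Nat.Base as ℕ using (ℕ; zero; suc; z≤n; s≤s)
open import Data.Nat.ListAction using (sum)
open import Data.Nat.ListAction.Properties using (sum-↭)
open import Data.Nat.Solver using (module +-*-Solver)
open import Data.Product.Base using (∃-syntax; _×_; _,_; proj₁; proj₂)
open import Data.Sum.Base using (inj₁; inj₂)
open import Function.Base using (_∘_; _on_)
import Relation.Binary.PropositionalEquality as ≡
open import Relation.Binary.Structures using (IsStrictPartialOrder)
open import Relation.Nullary.Decidable
  using (Dec; yes; no; does; ¬?; _×-dec_; dec-true; dec-false)
open import Relation.Nullary.Negation using (contradiction)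

-- Arithmetic in an ordered field without trichotomy.

module OrderedField {c ℓ₁ ℓ₂} (F : ArchimedeanOrderedField c ℓ₁ ℓ₂) where
  open ArchimedeanOrderedField F
  open IsStrictPartialOrder <-isStrictPartialOrder
    using (<-respˡ-≈; <-respʳ-≈) renaming (trans to <-trans; irrefl to <-irrefl)
  open import Algebra.Properties.CommutativeSemigroup *-commutativeSemigroup
    using (interchange; xy∙z≈xz∙y)
  open import Algebra.Properties.Semiring.Mult semiring using (×-homo-+; ×1-homo-*)
  open import Relation.Binary.Reasoning.Setoid setoid

  <-resp-≈ : ∀ {w x y z} → x ≈ w → y ≈ z → x < y → w < z
  <-resp-≈ x≈w y≈z x<y = <-respʳ-≈ y≈z (<-respˡ-≈ x≈w x<y)

  ≤-refl : ∀ {x} → x ≤ᶠ x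
  ≤-refl = <-irrefl refl

  -- Since `_≤ᶠ_` is a negated strict inequality, cotransitivity takes over the role of a case
  -- distinction by trichotomy, here and in `≤-<-trans`.
  <-≤-trans : ∀ {x y z} → x < y → y ≤ᶠ z → x < z
  <-≤-trans {z = z} x<y y≤z with <-cotrans x<y z
  ... | inj₁ x<z = x<z
  ... | inj₂ z<y = contradiction z<y y≤z

  ≤-<-trans : ∀ {x y z} → x ≤ᶠ y → y < z → x < z
  ≤-<-trans {x} x≤y y<z with <-cotrans y<z x
  ... | inj₁ y<x = contradiction y<x x≤y
  ... | inj₂ x<z = x<z

  ≤-trans : ∀ {x y z} → x ≤ᶠ y → y ≤ᶠ z → x ≤ᶠ z
  ≤-trans x≤y y≤z z<x = y≤z (<-≤-trans z<x x≤y)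

  +-cancelʳ-< : ∀ {x y} z → x +ᶠ z < y +ᶠ z → x < y
  +-cancelʳ-< {x} {y} z = λ x+z<y+z →
    <-resp-≈ (cancel x) (cancel y) (+-monoˡ-< (-ᶠ z) x+z<y+z)
    where
    cancel : ∀ w → w +ᶠ z +ᶠ -ᶠ z ≈ w
    cancel w = begin
      w +ᶠ z +ᶠ -ᶠ z    ≈⟨ +-assoc w z (-ᶠ z) ⟩
      w +ᶠ (z +ᶠ -ᶠ z)  ≈⟨ +-congˡ (-‿inverseʳ z) ⟩
      w +ᶠ 0#           ≈⟨ +-identityʳ w ⟩
      w                 ∎

  +-monoˡ-≤ : ∀ {x y} z → x ≤ᶠ y → x +ᶠ z ≤ᶠ y +ᶠ z
  +-monoˡ-≤ z x≤y y+z<x+z = x≤y (+-cancelʳ-< z y+z<x+z)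

  +-monoʳ-≤ : ∀ {x y} z → x ≤ᶠ y → z +ᶠ x ≤ᶠ z +ᶠ y
  +-monoʳ-≤ z x≤y z+y<z+x =
    +-monoˡ-≤ z x≤y (<-resp-≈ (+-comm z _) (+-comm z _) z+y<z+x)

  +-mono-≤ : ∀ {w x y z} → w ≤ᶠ x → y ≤ᶠ z → w +ᶠ y ≤ᶠ x +ᶠ z
  +-mono-≤ w≤x y≤z = ≤-trans (+-monoˡ-≤ _ w≤x) (+-monoʳ-≤ _ y≤z)

  *-monoˡ-< : ∀ {x y z} → 0# < z → x < y → x *ᶠ z < y *ᶠ z
  *-monoˡ-< {x} {y} {z} 0<z x<y =
    <-resp-≈ (+-identityˡ (x *ᶠ z)) difference
      (+-monoˡ-< (x *ᶠ z) (*-positive 0<y-x 0<z))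
    where
    0<y-x : 0# < y +ᶠ -ᶠ x
    0<y-x = <-respˡ-≈ (-‿inverseʳ x) (+-monoˡ-< (-ᶠ x) x<y)

    difference : (y +ᶠ -ᶠ x) *ᶠ z +ᶠ x *ᶠ z ≈ y *ᶠ z
    difference = begin
      (y +ᶠ -ᶠ x) *ᶠ z +ᶠ x *ᶠ z  ≈⟨ distribʳ z (y +ᶠ -ᶠ x) x ⟨
      (y +ᶠ -ᶠ x +ᶠ x) *ᶠ z       ≈⟨ *-congʳ (+-assoc y (-ᶠ x) x) ⟩
      (y +ᶠ (-ᶠ x +ᶠ x)) *ᶠ z     ≈⟨ *-congʳ (+-congˡ (-‿inverseˡ x)) ⟩
      (y +ᶠ 0#) *ᶠ z              ≈⟨ *-congʳ (+-identityʳ y) ⟩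
      y *ᶠ z                      ∎

  *-mono-<-square : ∀ {x y} → 0# < x → x < y → x *ᶠ x < y *ᶠ y
  *-mono-<-square {x} {y} 0<x x<y = <-trans (*-monoˡ-< 0<x x<y)
    (<-respˡ-≈ (*-comm x y) (*-monoˡ-< (<-trans 0<x x<y) x<y))

  fromℕ-mono-≤ : ∀ {m n} → m ℕ.≤ n → fromℕ m ≤ᶠ fromℕ n
  fromℕ-mono-≤ {n = zero}  z≤n       = ≤-refl
  fromℕ-mono-≤ {n = suc n} z≤n n+1<0 =
    +-mono-≤ (λ 1<0 → <-irrefl refl (<-trans 0<1 1<0)) (fromℕ-mono-≤ (z≤n {n}))
      (<-respʳ-≈ (sym (+-identityˡ 0#)) n+1<0)
  fromℕ-mono-≤ (s≤s m≤n) = +-monoʳ-≤ 1# (fromℕ-mono-≤ m≤n)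

  0<fromℕ : ∀ n .{{_ : ℕ.NonZero n}} → 0# < fromℕ n
  0<fromℕ (suc n) = <-≤-trans 0<1
    (≤-trans (λ 1+0<1 → <-irrefl (+-identityʳ 1#) 1+0<1) (fromℕ-mono-≤ (s≤s (z≤n {n}))))

  *-fromℕ-monoˡ-≤ : ∀ {x y} n → x ≤ᶠ y → x *ᶠ fromℕ n ≤ᶠ y *ᶠ fromℕ n
  *-fromℕ-monoˡ-≤ {x} {y} zero    x≤y y*0<x*0 =
    <-irrefl refl (<-resp-≈ (zeroʳ y) (zeroʳ x) y*0<x*0)
  *-fromℕ-monoˡ-≤ {x} {y} (suc n) x≤y y*n<x*n =
    +-mono-≤ x≤y (*-fromℕ-monoˡ-≤ n x≤y) (<-resp-≈ (expand y) (expand x) y*n<x*n)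
    where
    expand : ∀ z → z *ᶠ (1# +ᶠ fromℕ n) ≈ z +ᶠ z *ᶠ fromℕ n
    expand z = trans (distribˡ z 1# (fromℕ n)) (+-congʳ (*-identityʳ z))

  module _ {ε : Carrier} (0<ε : 0# < ε) where

    -- If `εk < 7`, squaring gives `(εk)² < 49`, whereas `49/ε² < n ≤ k²` gives `49 < (εk)²`. The
    -- goal is itself a negation, so the refutation is constructive.
    seven≤ε*k : ∀ k .{{_ : ℕ.NonZero k}} {n} →
                fromℕ 49 *ᶠ recip (ε *ᶠ ε) (*-positive 0<ε 0<ε) < fromℕ n →
                n ℕ.≤ k ℕ.* k → fromℕ 7 ≤ᶠ ε *ᶠ fromℕ k
    seven≤ε*k k 49/ε²<n n≤k² εk<7 =
      <-irrefl refl (<-trans 49<[εk]² [εk]²<49)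
      where
      ε² = ε *ᶠ ε
      1/ε² = recip ε² (*-positive 0<ε 0<ε)

      49<[εk]² : fromℕ 49 < (ε *ᶠ fromℕ k) *ᶠ (ε *ᶠ fromℕ k)
      49<[εk]² = <-resp-≈
        (begin
          fromℕ 49 *ᶠ 1/ε² *ᶠ ε²    ≈⟨ *-assoc _ 1/ε² ε² ⟩
          fromℕ 49 *ᶠ (1/ε² *ᶠ ε²)  ≈⟨ *-congˡ (trans (*-comm 1/ε² ε²)
                                         (proj₂ (#0⇒invertible ε² (inj₂ (*-positive 0<ε 0<ε))))) ⟩
          fromℕ 49 *ᶠ 1#            ≈⟨ *-identityʳ _ ⟩
          fromℕ 49                  ∎)
        (begin
          fromℕ (k ℕ.* k) *ᶠ ε²                ≈⟨ *-comm _ ε² ⟩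
          ε² *ᶠ fromℕ (k ℕ.* k)                ≈⟨ *-congˡ (×1-homo-* k k) ⟩
          ε² *ᶠ (fromℕ k *ᶠ fromℕ k)           ≈⟨ interchange ε ε (fromℕ k) (fromℕ k) ⟩
          (ε *ᶠ fromℕ k) *ᶠ (ε *ᶠ fromℕ k)     ∎)
        (*-monoˡ-< (*-positive 0<ε 0<ε) (<-≤-trans 49/ε²<n (fromℕ-mono-≤ n≤k²)))

      [εk]²<49 : (ε *ᶠ fromℕ k) *ᶠ (ε *ᶠ fromℕ k) < fromℕ 49
      [εk]²<49 = <-respʳ-≈ (sym (×1-homo-* 7 7))
        (*-mono-<-square (*-positive 0<ε (0<fromℕ k)) εk<7)

  module _ {ε : Carrier} where

    -- Suppose `m < (1 - ε)o`. Multiplying by `k` and adding `εko` gives `km + εko < ko`. As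
    -- `7o ≤ εko`, this contradicts the integer inequality.
    relative-error : ∀ k {m o} .{{_ : ℕ.NonZero k}} → fromℕ 7 ≤ᶠ ε *ᶠ fromℕ k →
      k ℕ.* o ℕ.≤ k ℕ.* m ℕ.+ 7 ℕ.* o → (1# -ᶠ ε) *ᶠ fromℕ o ≤ᶠ fromℕ m
    relative-error k {m} {o} 7≤εk ko≤km+7o m<[1-ε]o =
      fromℕ-mono-≤ ko≤km+7o
        (<-respˡ-≈ (sym (×-homo-+ 1# (k ℕ.* m) (7 ℕ.* o)))
          (≤-<-trans (+-monoʳ-≤ (fromℕ (k ℕ.* m)) 7o≤εko)
            (<-resp-≈ lhs rhs (+-monoˡ-< (ε *ᶠ fromℕ k *ᶠ fromℕ o)
              (*-monoˡ-< (0<fromℕ k) m<[1-ε]o)))))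
      where
      7o≤εko : fromℕ (7 ℕ.* o) ≤ᶠ ε *ᶠ fromℕ k *ᶠ fromℕ o
      7o≤εko εko<7o = *-fromℕ-monoˡ-≤ o 7≤εk (<-respʳ-≈ (×1-homo-* 7 o) εko<7o)

      lhs : fromℕ m *ᶠ fromℕ k +ᶠ ε *ᶠ fromℕ k *ᶠ fromℕ o ≈
            fromℕ (k ℕ.* m) +ᶠ ε *ᶠ fromℕ k *ᶠ fromℕ o
      lhs = +-congʳ (trans (*-comm _ _) (sym (×1-homo-* k m)))

      rhs : (1# -ᶠ ε) *ᶠ fromℕ o *ᶠ fromℕ k +ᶠ ε *ᶠ fromℕ k *ᶠ fromℕ o ≈ fromℕ (k ℕ.* o)
      rhs = begin
        (1# -ᶠ ε) *ᶠ fromℕ o *ᶠ fromℕ k +ᶠ ε *ᶠ fromℕ k *ᶠ fromℕ o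
          ≈⟨ +-cong (xy∙z≈xz∙y _ _ _) refl ⟩
        (1# -ᶠ ε) *ᶠ fromℕ k *ᶠ fromℕ o +ᶠ ε *ᶠ fromℕ k *ᶠ fromℕ o
          ≈⟨ distribʳ (fromℕ o) _ _ ⟨
        ((1# -ᶠ ε) *ᶠ fromℕ k +ᶠ ε *ᶠ fromℕ k) *ᶠ fromℕ o
          ≈⟨ *-congʳ (distribʳ (fromℕ k) _ _) ⟨
        (1# -ᶠ ε +ᶠ ε) *ᶠ fromℕ k *ᶠ fromℕ o
          ≈⟨ *-congʳ (*-congʳ (trans (+-assoc 1# (-ᶠ ε) ε)
               (trans (+-congˡ (-‿inverseˡ ε)) (+-identityʳ 1#)))) ⟩
        1# *ᶠ fromℕ k *ᶠ fromℕ o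
          ≈⟨ *-congʳ (*-identityˡ _) ⟩
        fromℕ k *ᶠ fromℕ o
          ≈⟨ ×1-homo-* k o ⟨
        fromℕ (k ℕ.* o)
          ∎

-- Sums over lists, restriction of functions, integer square roots.

module Naturals where
  open import Data.Nat.Base
  open import Data.Nat.Properties
  open ≡ using (_≡_; _≢_; refl; sym; trans; cong; cong₂; subst)

  module _ {a} {X : Set a} where

    ∑ : List X → (X → ℕ) → ℕ
    ∑ xs f = sum (map f xs)

    ∑-mono : ∀ {f g} xs → (∀ {x} → x ∈ xs → f x ≤ g x) → ∑ xs f ≤ ∑ xs g
    ∑-mono []       f≤g = z≤n
    ∑-mono (x ∷ xs) f≤g = +-mono-≤ (f≤g (here refl)) (∑-mono xs (f≤g ∘ there))

    ∑-+ : ∀ {f g} xs → ∑ xs (λ x → f x + g x) ≡ ∑ xs f + ∑ xs g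
    ∑-+         []       = refl
    ∑-+ {f} {g} (x ∷ xs) = trans (cong (f x + g x +_) (∑-+ xs))
      (+-*-Solver.solve 4 (λ m n p q → (m :+ n) :+ (p :+ q) := (m :+ p) :+ (n :+ q))
        refl (f x) (g x) (∑ xs f) (∑ xs g))
      where open +-*-Solver using (_:+_; _:=_)

    ∑-*ˡ : ∀ {f} k xs → ∑ xs (λ x → k * f x) ≡ k * ∑ xs f
    ∑-*ˡ     k []       = sym (*-zeroʳ k)
    ∑-*ˡ {f} k (x ∷ xs) = trans (cong (k * f x +_) (∑-*ˡ k xs)) (sym (*-distribˡ-+ k (f x) _))

    ∑-const : ∀ k xs → ∑ xs (λ _ → k) ≡ length xs * k
    ∑-const k []       = refl
    ∑-const k (x ∷ xs) = cong (k +_) (∑-const k xs)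

    ∑-↭ : ∀ f {xs ys} → xs ↭ ys → ∑ xs f ≡ ∑ ys f
    ∑-↭ f = sum-↭ ∘ map⁺ f

    ∈⇒↭ : ∀ {x : X} {xs} → x ∈ xs → ∃[ ys ] xs ↭ x ∷ ys
    ∈⇒↭ x∈xs with ys , zs , refl ← ∈-∃++ x∈xs = ys ++ zs , shift _ ys zs

    -- Each `y` of nonzero value cancels against one occurrence of it in `xs`. Since `ys` has no
    -- repetitions, the other nonzero entries of `ys` survive in what is left of `xs`.
    ∑-support : ∀ f {ys xs : List X} → Unique ys →
                (∀ {y} → y ∈ ys → f y ≢ 0 → y ∈ xs) → ∑ ys f ≤ ∑ xs f
    ∑-support f []            ys⊆xs = z≤n
    ∑-support f {y ∷ ys} {xs} (y∉ys ∷ ys!) ys⊆xs with f y ≟ 0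
    ... | yes fy≡0 = subst (λ n → n + ∑ ys f ≤ ∑ xs f) (sym fy≡0)
                       (∑-support f ys! (ys⊆xs ∘ there))
    ... | no  fy≢0 with zs , xs↭y∷zs ← ∈⇒↭ (ys⊆xs (here refl) fy≢0) =
      subst (f y + ∑ ys f ≤_) (sym (∑-↭ f xs↭y∷zs))
        (+-monoʳ-≤ (f y) (∑-support f ys! ys⊆zs))
      where
      ys⊆zs : ∀ {x} → x ∈ ys → f x ≢ 0 → x ∈ zs
      ys⊆zs x∈ys fx≢0 with ∈-resp-↭ xs↭y∷zs (ys⊆xs (there x∈ys) fx≢0)
      ... | here x≡y   = contradiction (sym x≡y) (All.lookup y∉ys x∈ys)
      ... | there x∈zs = x∈zs

  module _ {a b} {X : Set a} {Y : Set b} where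

    ∑-map : ∀ (h : X → Y) f xs → ∑ xs (f ∘ h) ≡ ∑ (map h xs) f
    ∑-map h f xs = cong sum (map-∘ xs)

    -- This moves a sum from one edge set to another when the summand depends on one endpoint only:
    -- `h` is `proj₁` or `proj₂`, and disjointness of a matching provides the distinctness.
    ∑-support-on : ∀ (h : X → Y) f {ys xs} → AllPairs (_≢_ on h) ys →
                   (∀ {y} → y ∈ map h ys → f y ≢ 0 → y ∈ map h xs) →
                   ∑ ys (f ∘ h) ≤ ∑ xs (f ∘ h)
    ∑-support-on h f {ys} {xs} ys! ys⊆xs = begin
      ∑ ys (f ∘ h)    ≡⟨ ∑-map h f ys ⟩
      ∑ (map h ys) f  ≤⟨ ∑-support f (AllPairs.map⁺ ys!) ys⊆xs ⟩
      ∑ (map h xs) f  ≡⟨ ∑-map h f xs ⟨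
      ∑ xs (f ∘ h)    ∎
      where open ≤-Reasoning

    ⊆-length : ∀ (h : X → Y) {ys xs} → AllPairs (_≢_ on h) ys →
               (∀ {y} → y ∈ map h ys → y ∈ map h xs) → length ys ≤ length xs
    ⊆-length h {ys} {xs} ys! ys⊆xs = begin
      length ys          ≡⟨ *-identityʳ _ ⟨
      length ys * 1      ≡⟨ ∑-const 1 ys ⟨
      ∑ ys (λ _ → 1)     ≤⟨ ∑-support-on h (λ _ → 1) ys! (λ y∈ys _ → ys⊆xs y∈ys) ⟩
      ∑ xs (λ _ → 1)     ≡⟨ ∑-const 1 xs ⟩
      length xs * 1      ≡⟨ *-identityʳ _ ⟩
      length xs          ∎
      where open ≤-Reasoning

  indicator : ∀ {p} {P : Set p} → Dec P → ℕ
  indicator (yes _) = 1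
  indicator (no  _) = 0

  indicator-≤ : ∀ {p} {P : Set p} (P? : Dec P) {n} → (P → 1 ≤ n) → indicator P? ≤ n
  indicator-≤ (yes p) 1≤n = 1≤n p
  indicator-≤ (no  _) _   = z≤n

  module Restriction {a p} {X : Set a} {P : X → Set p} (P? : ∀ x → Dec (P x)) where

    -- Extension by zero: it turns a statement about vertices covered by a matching into one about
    -- the support of a function, as `∑-support` requires.
    _↾ : (X → ℕ) → X → ℕ
    (f ↾) x = if does (P? x) then f x else 0

    ↾-true : ∀ f {x} → P x → (f ↾) x ≡ f x
    ↾-true f {x} px = cong (if_then f x else 0) (dec-true (P? x) px)

    ↾-support : ∀ f {x} → (f ↾) x ≢ 0 → P x
    ↾-support f {x} fx≢0 with P? x
    ... | yes px = px
    ... | no  _  = contradiction refl fx≢0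

  integer-sqrt : ∀ n → ∃[ k ] k * k ≤ n × suc n ≤ suc k * suc k
  integer-sqrt zero = 0 , z≤n , s≤s z≤n
  integer-sqrt (suc n) with k , k²≤n , n<k′² ← integer-sqrt n
    with m≤n⇒m<n∨m≡n n<k′²
  ... | inj₁ n′<k′² = k , m≤n⇒m≤1+n k²≤n , n′<k′²
  ... | inj₂ n′≡k′² = suc k , ≤-reflexive (sym n′≡k′²)
                    , subst (_< suc (suc k) * suc (suc k)) (sym n′≡k′²)
                        (*-mono-< (n<1+n (suc k)) (n<1+n (suc k)))

-- Rounds of the algorithm and their invariants.

module Execution (G : BipartiteGraph) where
  open Naturals
  open import Data.Nat.Base
  open import Data.Nat.Properties
  open ≡ using (_≡_; _≢_; refl; sym; trans; cong; cong₂; subst)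
  open BipartiteGraph G
  open Matchings G
  open ALT G
  open DecMembership (Fin._≟_ {∣A∣}) using () renaming (_∈?_ to _∈A?_)
  open DecMembership (Fin._≟_ {∣B∣}) using () renaming (_∈?_ to _∈B?_)
  open State

  matching-A : ∀ {R N} → IsMatching R N → AllPairs (_≢_ on proj₁) N
  matching-A = AllPairs.map proj₁ ∘ proj₂

  matching-B : ∀ {R N} → IsMatching R N → AllPairs (_≢_ on proj₂) N
  matching-B = AllPairs.map proj₂ ∘ proj₂

  -- Otherwise both endpoints would be free and `ab` could be added to `N`.
  maximal-blocks : ∀ {R N a b} → IsMaximalMatching R N → R a b → a ∉ A⟨ N ⟩ → b ∈ B⟨ N ⟩
  maximal-blocks {R} {N} {a} {b} ((inR , disjoint) , maximal) ab a∉N with b ∈B? B⟨ N ⟩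
  ... | yes b∈N = b∈N
  ... | no  b∉N = contradiction
    (ab ∷ inR ,
     All.tabulate (λ e∈N → (λ { refl → a∉N (∈-map⁺ proj₁ e∈N) })
                         , (λ { refl → b∉N (∈-map⁺ proj₂ e∈N) })) ∷ disjoint)
    (maximal (a , b) ab)

  module _ (s : State) (N : List Edge) where

    c-∈ : ∀ {b} → b ∈ B⟨ N ⟩ → c (update s N) b ≡ suc (c s b)
    c-∈ {b} b∈N =
      cong (if_then suc (c s b) else c s b) (dec-true (b ∈B? B⟨ N ⟩) b∈N)

    c-∉ : ∀ {b} → b ∉ B⟨ N ⟩ → c (update s N) b ≡ c s b
    c-∉ {b} b∉N =
      cong (if_then suc (c s b) else c s b) (dec-false (b ∈B? B⟨ N ⟩) b∉N)

    c-mono : ∀ b → c s b ≤ c (update s N) b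
    c-mono b with b ∈B? B⟨ N ⟩
    ... | yes b∈N = n≤1+n _
    ... | no  b∉N = ≤-refl

    kept? : (e : Edge) → Dec (proj₂ e ∉ B⟨ N ⟩)
    kept? e = ¬? (proj₂ e ∈B? B⟨ N ⟩)

    -- An edge is discarded only when an edge of `N` takes over its `B`-vertex. Hence the size of
    -- `M` never drops.
    update-B : ∀ {b} → b ∈ B⟨ M s ⟩ → b ∈ B⟨ M (update s N) ⟩
    update-B {b} b∈M with b ∈B? B⟨ N ⟩ | ∈-map⁻ proj₂ b∈M
    ... | no  b∉N | _ , e∈M , refl = ∈-map⁺ proj₂ (∈-++⁺ˡ (∈-filter⁺ kept? e∈M b∉N))
    ... | yes b∈N | _ with _ , e∈N , refl ← ∈-map⁻ proj₂ b∈N =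
      ∈-map⁺ proj₂ (∈-++⁺ʳ (filter kept? (M s)) e∈N)

  -- `tight` and `sold` are the complementary slackness conditions for the prices `c`, the first one
  -- up to an error of 1.
  record Invariant (s : State) : Set where
    field
      matching : IsMatching _~_ (M s)
      tight    : ∀ {a b b′} → (a , b) ∈ M s → a ~ b′ → c s b ≤ suc (c s b′)
      sold     : ∀ {b} → c s b ≢ 0 → b ∈ B⟨ M s ⟩

  open Invariant

  -- Kept edges avoid `B⟨ N ⟩` and edges of `H s` avoid `A⟨ M s ⟩`, so the union is a matching. For
  -- `tight`, a kept edge has an unchanged price while no other price falls, and a new edge was
  -- cheapest before its price rose by 1.
  update-invariant : ∀ {s N} → Invariant s → IsMatching (H s) N → Invariant (update s N)
  update-invariant {s} {N} inv (N⊆H , disjoint) = record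
    { matching = All.++⁺ (All.filter⁺ (kept? s N) (proj₁ (matching inv))) (All.map proj₁ N⊆H)
               , AllPairs.++⁺ (AllPairs.filter⁺ (kept? s N) (proj₂ (matching inv))) disjoint
                   (All.tabulate λ e∈M → All.tabulate λ e′∈N →
                     let e∈M , b∉N = ∈-filter⁻ (kept? s N) e∈M
                         _ , a∉M , _ = All.lookup N⊆H e′∈N
                     in (λ { refl → a∉M (∈-map⁺ proj₁ e∈M) })
                      , (λ { refl → b∉N (∈-map⁺ proj₂ e′∈N) }))
    ; tight    = tight′
    ; sold     = sold′
    }
    where
    open ≤-Reasoning

    tight′ : ∀ {a b b′} → (a , b) ∈ M (update s N) → a ~ b′ →
             c (update s N) b ≤ suc (c (update s N) b′)
    tight′ {a} {b} {b′} e∈M′ a~b′ with ∈-++⁻ (filter (kept? s N) (M s)) e∈M′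
    ... | inj₁ e∈filter with e∈M , b∉N ← ∈-filter⁻ (kept? s N) e∈filter = begin
      c (update s N) b         ≡⟨ c-∉ s N b∉N ⟩
      c s b                    ≤⟨ tight inv e∈M a~b′ ⟩
      suc (c s b′)             ≤⟨ s≤s (c-mono s N b′) ⟩
      suc (c (update s N) b′)  ∎
    ... | inj₂ e∈N with _ , _ , _ , minimal ← All.lookup N⊆H e∈N = begin
      c (update s N) b         ≡⟨ c-∈ s N (∈-map⁺ proj₂ e∈N) ⟩
      suc (c s b)              ≤⟨ s≤s (minimal b′ a~b′) ⟩
      suc (c s b′)             ≤⟨ s≤s (c-mono s N b′) ⟩
      suc (c (update s N) b′)  ∎

    sold′ : ∀ {b} → c (update s N) b ≢ 0 → b ∈ B⟨ M (update s N) ⟩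
    sold′ {b} c′b≢0 with b ∈B? B⟨ N ⟩
    ... | no  _   = update-B s N (sold inv c′b≢0)
    ... | yes b∈N with _ , e∈N , refl ← ∈-map⁻ proj₂ b∈N =
      ∈-map⁺ proj₂ (∈-++⁺ʳ (filter (kept? s N) (M s)) e∈N)

  reachable-invariant : ∀ {r s} → Reachable r s → Invariant s
  reachable-invariant start = record
    { matching = [] , [] ; tight = λ () ; sold = λ 0≢0 → contradiction refl 0≢0 }
  reachable-invariant (round N reach (isMatching , _)) =
    update-invariant (reachable-invariant reach) isMatching

  update-length : ∀ {s} N → Invariant s → length (M s) ≤ length (M (update s N))
  update-length {s} N inv = ⊆-length proj₂ (matching-B (matching inv)) (update-B s N)

  -- Capped prices and weak duality.

  module _ (L : ℕ) where

    price : State → Fin ∣B∣ → ℕ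
    price s b = c s b ⊓ L

    -- The default `L` of the minimum is both the cap and the value at a vertex without neighbours,
    -- which makes this total where `IsCMin` is only a relation.
    lowest : State → Fin ∣A∣ → ℕ
    lowest s a = Extrema.min L (map (c s) (filter (a ~?_) (allFin ∣B∣)))

    lowest≤L : ∀ s a → lowest s a ≤ L
    lowest≤L s a = Extrema.min≤⊤ L (map (c s) (filter (a ~?_) (allFin ∣B∣)))

    lowest≤c : ∀ s {a b} → a ~ b → lowest s a ≤ c s b
    lowest≤c s {a} {b} a~b =
      All.lookup (Extrema.min≤xs L (map (c s) (filter (a ~?_) (allFin ∣B∣))))
        (∈-map⁺ (c s) (∈-filter⁺ (a ~?_) (∈-allFin b) a~b))

    lowest-greatest : ∀ s {a k} → k ≤ L → (∀ b → a ~ b → k ≤ c s b) → k ≤ lowest s a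
    lowest-greatest s {a} {k} k≤L k≤c =
      Extrema.v≤min⁺ k≤L (All.map⁺ (All.tabulate λ {b} b∈ →
        k≤c b (proj₂ (∈-filter⁻ (a ~?_) {xs = allFin ∣B∣} b∈))))

    lowest≤price : ∀ s {a b} → a ~ b → lowest s a ≤ price s b
    lowest≤price s a~b = ⊓-glb (lowest≤c s a~b) (lowest≤L s _)

    Bidder : State → Fin ∣A∣ → Set
    Bidder s a = a ∉ A⟨ M s ⟩ × lowest s a < L

    bidder? : ∀ s a → Dec (Bidder s a)
    bidder? s a = ¬? (a ∈A? A⟨ M s ⟩) ×-dec (lowest s a <? L)

    bids : State → Fin ∣A∣ → ℕ
    bids s a = indicator (bidder? s a)

    -- Weak LP duality: prices on B together with utilities on matched A-vertices
    -- cover every edge without a bidder at least L times, and every edge of M at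
    -- most L + 1 times.
    duality : ∀ {s} O → Invariant s → IsMatching _~_ O →
              length O * L ≤ length (M s) * suc L + L * ∑ O (bids s ∘ proj₁)
    duality {s} O inv matchingO = begin
      length O * L
        ≡⟨ ∑-const L O ⟨
      ∑ O (λ _ → L)
        ≤⟨ ∑-mono O (λ e∈O → covered (All.lookup (proj₁ matchingO) e∈O)) ⟩
      ∑ O (λ e → utility (proj₁ e) + price s (proj₂ e) + L * bids s (proj₁ e))
        ≡⟨ trans (∑-+ O) (cong₂ _+_ (∑-+ O) (∑-*ˡ L O)) ⟩
      ∑ O (utility ∘ proj₁) + ∑ O (price s ∘ proj₂) + L * u
        -- Both sums pass from `O` to `M s`: `utility` vanishes off `A⟨ M s ⟩` by restriction, and
        -- `price s` vanishes off `B⟨ M s ⟩` by `sold`.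
        ≤⟨ +-monoˡ-≤ (L * u) (+-mono-≤
             (∑-support-on proj₁ utility (matching-A matchingO) (λ _ → ↾-support slack))
             (∑-support-on proj₂ (price s) (matching-B matchingO)
               (λ _ p≢0 → sold inv (λ c≡0 → p≢0 (cong (_⊓ L) c≡0))))) ⟩
      ∑ (M s) (utility ∘ proj₁) + ∑ (M s) (price s ∘ proj₂) + L * u
        ≡⟨ cong (_+ L * u) (∑-+ (M s)) ⟨
      ∑ (M s) (λ e → utility (proj₁ e) + price s (proj₂ e)) + L * u
        ≤⟨ +-monoˡ-≤ (L * u) (∑-mono (M s) loose) ⟩
      ∑ (M s) (λ _ → suc L) + L * u
        ≡⟨ cong (_+ L * u) (∑-const (suc L) (M s)) ⟩
      length (M s) * suc L + L * u
        ∎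
      where
      open ≤-Reasoning
      open Restriction (λ a → a ∈A? A⟨ M s ⟩)

      u = ∑ O (bids s ∘ proj₁)

      slack utility : Fin ∣A∣ → ℕ
      slack a = L ∸ lowest s a
      utility = slack ↾

      -- A matched `a` has utility filling the gap up to `L`, a bidder contributes `L` through its
      -- bid, and any other `a` sees only neighbours of price at least `L`.
      covered : ∀ {a b} → a ~ b → L ≤ utility a + price s b + L * bids s a
      covered {a} {b} a~b with a ∈A? A⟨ M s ⟩ | lowest s a <? L
      ... | yes _ | _ = begin
        L                              ≡⟨ m∸n+n≡m (lowest≤L s a) ⟨
        L ∸ lowest s a + lowest s a    ≤⟨ +-monoʳ-≤ _ (lowest≤price s a~b) ⟩
        L ∸ lowest s a + price s b     ≤⟨ m≤m+n _ _ ⟩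
        L ∸ lowest s a + price s b + _ ∎
      ... | no _ | yes _ = ≤-trans (≤-reflexive (sym (*-identityʳ L))) (m≤n+m _ _)
      ... | no _ | no ≮L = ≤-trans (≤-trans (≮⇒≥ ≮L) (lowest≤price s a~b)) (m≤m+n _ _)

      loose : ∀ {e} → e ∈ M s → utility (proj₁ e) + price s (proj₂ e) ≤ suc L
      loose {a , b} e∈M = begin
        utility a + price s b
          ≡⟨ cong (_+ price s b) (↾-true slack (∈-map⁺ proj₁ e∈M)) ⟩
        L ∸ lowest s a + price s b
          ≤⟨ +-monoʳ-≤ (L ∸ lowest s a) price≤ ⟩
        L ∸ lowest s a + suc (lowest s a)
          ≡⟨ +-suc _ _ ⟩
        suc (L ∸ lowest s a + lowest s a)
          ≡⟨ cong suc (m∸n+n≡m (lowest≤L s a)) ⟩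
        suc L
          ∎
        where
        pred-price≤ : pred (price s b) ≤ lowest s a
        -- Taking the predecessor absorbs the extra 1 of `tight`, leaving a lower bound on all
        -- neighbouring prices. A zero price, where `pred` truncates, does no harm.
        pred-price≤ = lowest-greatest s (≤-trans pred[n]≤n (m⊓n≤n (c s b) L))
          λ b′ a~b′ → ≤-trans (pred-mono-≤ (m⊓n≤m (c s b) L)) (pred-mono-≤ (tight inv e∈M a~b′))

        price≤ : price s b ≤ suc (lowest s a)
        price≤ = ≤-trans (suc-pred-≤ (price s b)) (s≤s pred-price≤)
          where
          suc-pred-≤ : ∀ n → n ≤ suc (pred n)
          suc-pred-≤ zero    = z≤n
          suc-pred-≤ (suc n) = ≤-refl

    -- Charging bids to a potential.

    module _ (O : List Edge) (matchingO : IsMatching _~_ O) where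

      -- Cheapest prices are summed over the `A`-vertices of `O`, whose bids are counted, but prices
      -- over all of `B`, since a bidder may be matched to a vertex outside `B⟨ O ⟩`.
      potential : State → ℕ
      potential s = ∑ O (lowest s ∘ proj₁) + ∑ (allFin ∣B∣) (price s)

      -- A bidder that stays unmatched has all its cheapest neighbours repriced, and
      -- one that becomes matched raises the price it pays.
      potential-step : ∀ {s N} → IsMaximalMatching (H s) N →
                       potential s + ∑ O (bids s ∘ proj₁) ≤ potential (update s N)
      potential-step {s} {N} maximal@((N⊆H , disjoint) , _) = begin
        ∑ O (lowest s ∘ proj₁) + ∑ Bs (price s) + ∑ O (bids s ∘ proj₁)
          ≡⟨ xy∙z≈xz∙y (∑ O (lowest s ∘ proj₁)) _ _ ⟩
        ∑ O (lowest s ∘ proj₁) + ∑ O (bids s ∘ proj₁) + ∑ Bs (price s)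
          ≡⟨ cong (_+ ∑ Bs (price s)) (∑-+ O) ⟨
        ∑ O (λ e → lowest s (proj₁ e) + bids s (proj₁ e)) + ∑ Bs (price s)
          ≤⟨ +-monoˡ-≤ _ (∑-mono O λ e∈O → unmatched (All.lookup (proj₁ matchingO) e∈O)) ⟩
        ∑ O (λ e → lowest s′ (proj₁ e) + (bids s ↾) (proj₁ e)) + ∑ Bs (price s)
          ≡⟨ cong (_+ ∑ Bs (price s)) (∑-+ O) ⟩
        ∑ O (lowest s′ ∘ proj₁) + ∑ O ((bids s ↾) ∘ proj₁) + ∑ Bs (price s)
          ≤⟨ +-monoˡ-≤ _ (+-monoʳ-≤ (∑ O (lowest s′ ∘ proj₁)) bids≤raises) ⟩
        ∑ O (lowest s′ ∘ proj₁) + ∑ Bs raise + ∑ Bs (price s)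
          ≡⟨ +-assoc (∑ O (lowest s′ ∘ proj₁)) _ _ ⟩
        ∑ O (lowest s′ ∘ proj₁) + (∑ Bs raise + ∑ Bs (price s))
          ≡⟨ cong (∑ O (lowest s′ ∘ proj₁) +_) (∑-+ Bs) ⟨
        ∑ O (lowest s′ ∘ proj₁) + ∑ Bs (λ b → raise b + price s b)
          ≤⟨ +-monoʳ-≤ (∑ O (lowest s′ ∘ proj₁)) (∑-mono Bs λ {b} _ →
               ≤-reflexive (m∸n+n≡m (⊓-monoˡ-≤ L (c-mono s N b)))) ⟩
        ∑ O (lowest s′ ∘ proj₁) + ∑ Bs (price s′)
          ∎
        where
        open ≤-Reasoning
        open Restriction (λ a → a ∈A? A⟨ N ⟩)
        open import Algebra.Properties.CommutativeSemigroup +-commutativeSemigroup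
          using (xy∙z≈xz∙y)

        s′ = update s N
        Bs = allFin ∣B∣

        raise : Fin ∣B∣ → ℕ
        raise b = price s′ b ∸ price s b

        lowest-mono : ∀ a → lowest s a ≤ lowest s′ a
        lowest-mono a = lowest-greatest s′ (lowest≤L s a)
          λ b a~b → ≤-trans (lowest≤c s a~b) (c-mono s N b)

        lowest-rises : ∀ {a} → Bidder s a → a ∉ A⟨ N ⟩ → suc (lowest s a) ≤ lowest s′ a
        lowest-rises {a} (a∉M , lowest<L) a∉N = lowest-greatest s′ lowest<L rises
          where
          rises : ∀ b → a ~ b → suc (lowest s a) ≤ c s′ b
          rises b a~b with m≤n⇒m<n∨m≡n (lowest≤c s a~b)
          ... | inj₁ lowest<c = ≤-trans lowest<c (c-mono s N b)
          -- Here `b` attains the lower bound `lowest s a`, so `ab` is an edge of `H s`. As `a` is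
          -- missed by `N`, maximality puts `b` into `B⟨ N ⟩` and its price rises.
          ... | inj₂ lowest≡c = ≤-reflexive (trans (cong suc lowest≡c) (sym (c-∈ s N
            (maximal-blocks maximal
              (a~b , a∉M , (b , a~b , refl) ,
                λ b′ a~b′ → subst (_≤ c s b′) lowest≡c (lowest≤c s a~b′))
              a∉N))))

        -- Bids from outside `A⟨ N ⟩` are paid by the rise of `lowest`. The remaining ones stay on
        -- the right, to be charged to prices by `bids≤raises`.
        unmatched : ∀ {a b} → a ~ b → lowest s a + bids s a ≤ lowest s′ a + (bids s ↾) a
        unmatched {a} a~b with a ∈A? A⟨ N ⟩ | bidder? s a
        ... | yes _   | _          = +-monoˡ-≤ _ (lowest-mono a)
        ... | no  a∉N | yes bidder = begin
          lowest s a + 1      ≡⟨ +-comm _ 1 ⟩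
          suc (lowest s a)    ≤⟨ lowest-rises bidder a∉N ⟩
          lowest s′ a         ≡⟨ +-identityʳ _ ⟨
          lowest s′ a + 0     ∎
        ... | no  _   | no  _      = +-monoˡ-≤ 0 (lowest-mono a)

        pays : ∀ {e} → e ∈ N → bids s (proj₁ e) ≤ raise (proj₂ e)
        pays {a , b} e∈N = indicator-≤ (bidder? s a) 1≤raise
          where
          1≤raise : Bidder s a → 1 ≤ raise b
          1≤raise (_ , lowest<L) = m<n⇒0<n∸m (begin-strict
            c s b ⊓ L       ≡⟨ m≤n⇒m⊓n≡m (<⇒≤ c<L) ⟩
            c s b           <⟨ n<1+n _ ⟩
            suc (c s b)     ≡⟨ m≤n⇒m⊓n≡m c<L ⟨
            suc (c s b) ⊓ L ≡⟨ cong (_⊓ L) (c-∈ s N (∈-map⁺ proj₂ e∈N)) ⟨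
            c s′ b ⊓ L      ∎)
            where
            c<L : c s b < L
            -- The cap must not hide the raise. If `L ≤ c s b`, then all neighbours of `a` cost at
            -- least `L`, because `b` is a cheapest one, and `a` would be no bidder.
            c<L with _ , _ , _ , minimal ← All.lookup N⊆H e∈N with <-≤-connex (c s b) L
            ... | inj₁ c<L = c<L
            ... | inj₂ L≤c = contradiction
              (lowest-greatest s ≤-refl λ b′ a~b′ → ≤-trans L≤c (minimal b′ a~b′))
              (<⇒≱ lowest<L)

        -- Each bidder matched by `N` is charged to its partner. Partners are distinct, so no raise
        -- is charged twice.
        bids≤raises : ∑ O ((bids s ↾) ∘ proj₁) ≤ ∑ Bs raise
        bids≤raises = begin
          ∑ O ((bids s ↾) ∘ proj₁)
            ≤⟨ ∑-support-on proj₁ (bids s ↾) (matching-A matchingO) (λ _ → ↾-support (bids s)) ⟩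
          ∑ N ((bids s ↾) ∘ proj₁)
            ≤⟨ ∑-mono N (λ e∈N → ≤-trans
                 (≤-reflexive (↾-true (bids s) (∈-map⁺ proj₁ e∈N))) (pays e∈N)) ⟩
          ∑ N (raise ∘ proj₂)
            ≡⟨ ∑-map proj₂ raise N ⟩
          ∑ B⟨ N ⟩ raise
            ≤⟨ ∑-support raise (AllPairs.map⁺ (AllPairs.map proj₂ disjoint))
                 (λ {b} _ _ → ∈-allFin b) ⟩
          ∑ Bs raise
            ∎

      -- By `sold`, only the vertices of `B⟨ M s ⟩` have a positive price, so the size of `B` does
      -- not enter.
      potential-≤ : ∀ {s} → Invariant s → potential s ≤ length O * L + length (M s) * L
      potential-≤ {s} inv = +-mono-≤
        (begin
          ∑ O (lowest s ∘ proj₁)  ≤⟨ ∑-mono O (λ _ → lowest≤L s _) ⟩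
          ∑ O (λ _ → L)           ≡⟨ ∑-const L O ⟩
          length O * L            ∎)
        (begin
          ∑ (allFin ∣B∣) (price s)  ≤⟨ ∑-support (price s) (allFin⁺ ∣B∣)
                                         (λ _ p≢0 → sold inv (λ c≡0 → p≢0 (cong (_⊓ L) c≡0))) ⟩
          ∑ B⟨ M s ⟩ (price s)      ≡⟨ ∑-map proj₂ (price s) (M s) ⟨
          ∑ (M s) (price s ∘ proj₂) ≤⟨ ∑-mono (M s) (λ {e} _ → m⊓n≤n (c s (proj₂ e)) L) ⟩
          ∑ (M s) (λ _ → L)         ≡⟨ ∑-const L (M s) ⟩
          length (M s) * L          ∎)
        where open ≤-Reasoning

      -- Induction on the rounds adds up the inequalities of `duality`. The bids telescope through
      -- `potential-step`, and earlier matchings are replaced by the current one, which is at least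
      -- as large.
      potential-bound : ∀ {r s} → Reachable r s →
        r * (length O * L) ≤ r * (length (M s) * suc L) + L * potential s
      potential-bound start = z≤n
      potential-bound (round {r} {s} N reach maximal) = begin
        o + r * o
          ≤⟨ +-mono-≤ (duality O inv matchingO) (potential-bound reach) ⟩
        (m + L * u) + (r * m + L * potential s)
          ≡⟨ +-*-Solver.solve 5
               (λ m l u rm p → (m :+ l :* u) :+ (rm :+ l :* p) := (m :+ rm) :+ l :* (p :+ u))
               refl m L u (r * m) (potential s) ⟩
        suc r * m + L * (potential s + u)
          ≤⟨ +-mono-≤ (*-monoʳ-≤ (suc r) (*-monoˡ-≤ (suc L) (update-length N inv)))
               (*-monoʳ-≤ L (potential-step maximal)) ⟩
        suc r * (length (M (update s N)) * suc L) + L * potential (update s N)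
          ∎
        where
        open ≤-Reasoning
        open +-*-Solver using (_:+_; _:*_; _:=_)
        inv = reachable-invariant reach
        o = length O * L
        m = length (M s) * suc L
        u = ∑ O (bids s ∘ proj₁)

  -- The cap L ≈ √R balances the two losses 1/L and 2L/R.
  approximation : ∀ {R s} O → Reachable R s → IsMaximumMatching _~_ O →
    ∃[ k ] suc R ≤ suc k * suc k ×
           suc k * length O ≤ suc k * length (M s) + 7 * length O
  -- Without rounds there is no `R` to cancel; the multiplier 1 works because `o ≤ 7 * o`.
  approximation {zero} {s} O reach _ = 0 , s≤s z≤n ,
    ≤-trans (*-monoˡ-≤ (length O) (s≤s (z≤n {6}))) (m≤n+m (7 * length O) (1 * length (M s)))
  approximation {R@(suc _)} {s} O reach (matchingO , maximum)
    with L , L²≤R , R<k² ← integer-sqrt R = L , R<k² , (begin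
      -- The multiplier is `suc L` because the square root has to be rounded up. This costs one `o`
      -- on top of the three in `bound`; the total is padded to 7, the square root of 49.
      o + L * o                          ≤⟨ +-monoʳ-≤ o (*-cancelˡ-≤ R bound) ⟩
      o + (L * m + 3 * o)                ≤⟨ m≤m+n _ (m + 3 * o) ⟩
      o + (L * m + 3 * o) + (m + 3 * o)  ≡⟨ solve 3 (λ o lm m →
          (o :+ (lm :+ con 3 :* o)) :+ (m :+ con 3 :* o) := (m :+ lm) :+ con 7 :* o)
          refl o (L * m) m ⟩
      suc L * m + 7 * o                  ∎)
    where
    open ≤-Reasoning
    open +-*-Solver
    o = length O
    m = length (M s)
    inv = reachable-invariant reach

    bound : R * (L * o) ≤ R * (L * m + 3 * o)
    bound = begin
      R * (L * o)
        ≡⟨ cong (R *_) (*-comm L o) ⟩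
      R * (o * L)
        ≤⟨ potential-bound L O matchingO reach ⟩
      R * (m * suc L) + L * potential L O matchingO s
        ≤⟨ +-monoʳ-≤ (R * (m * suc L)) (*-monoʳ-≤ L (potential-≤ L O matchingO inv)) ⟩
      R * (m * suc L) + L * (o * L + m * L)
        ≡⟨ solve 4 (λ r l o m → r :* (m :* (con 1 :+ l)) :+ l :* (o :* l :+ m :* l) :=
             r :* (l :* m) :+ (r :* m :+ (l :* l) :* (o :+ m))) refl R L o m ⟩
      R * (L * m) + (R * m + L * L * (o + m))
        -- One copy of `o` comes from the 1 in `suc L`, and two from the final potential, using
        -- `L * L ≤ R` and `m ≤ o`.
        ≤⟨ +-monoʳ-≤ (R * (L * m)) (+-mono-≤ (*-monoʳ-≤ R m≤o)
             (*-mono-≤ L²≤R (+-monoʳ-≤ o m≤o))) ⟩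
      R * (L * m) + (R * o + R * (o + o))
        ≡⟨ solve 4 (λ r l o m → r :* (l :* m) :+ (r :* o :+ r :* (o :+ o)) :=
             r :* (l :* m :+ con 3 :* o)) refl R L o m ⟩
      R * (L * m + 3 * o)
        ∎
      where m≤o = maximum (M s) (matching inv)

-- Transfer of the integer bound to the field of `ε`.

theorem3 : ∀ {c ℓ₁ ℓ₂} (F : ArchimedeanOrderedField c ℓ₁ ℓ₂) (G : BipartiteGraph) →
    let open ArchimedeanOrderedField F
        open BipartiteGraph G
        open Matchings G
        open ALT G
    in (ε : Carrier) (0<ε : 0# < ε) (M : List Edge) → Returns F ε 0<ε M →
       IsMatching _~_ M ×
       (∀ OPT → IsMaximumMatching _~_ OPT →
         (1# -ᶠ ε) *ᶠ fromℕ (length OPT) ≤ᶠ fromℕ (length M))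
theorem3 F G ε 0<ε M (R , (_ , 49/ε²<R+1) , p , reach) =
  Invariant.matching (reachable-invariant reach) , bound
  where
  open ArchimedeanOrderedField F
  open BipartiteGraph G
  open Matchings G
  open OrderedField F
  open Execution G

  bound : ∀ OPT → IsMaximumMatching _~_ OPT →
          (1# -ᶠ ε) *ᶠ fromℕ (length OPT) ≤ᶠ fromℕ (length M)
  -- The floor enters as `49/ε² < R + 1 ≤ (k + 1)²`, which makes `7/(k + 1)` at most `ε`.
  bound OPT maximum with k , R<k² , k∣OPT∣≤k∣M∣+7∣OPT∣ ← approximation OPT reach maximum =
    relative-error (suc k) {m = length M} (seven≤ε*k 0<ε (suc k) 49/ε²<R+1 R<k²)
      k∣OPT∣≤k∣M∣+7∣OPT∣
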